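{- Let $n\ge 1$, let $X$ be the number of lucky cars of a uniformly random parking function of $1,\ldots,n$, and let \[ f(x)=\frac1{n+1}\prod_{i=1}^n\big((n+2-i)x+(i-1)\big). \] Then for every integer $\ell\ge 1$, \[ E\big(X(X-1)\cdots(X-(\ell-1))\big)=\frac{1}{(n+1)^{n-1}}f^{(\ell)}(1), \] where $f^{(\ell)}$ denotes the $\ell$-th derivative of $f$.
   Context: There are $n$ spots labeled $1,\ldots,n$ in order along a one-way street, and $n$ cars entering one after another, car $i$ having preference $a_i\in\{1,\ldots,n\}$. Each car drives to its preferred spot and parks there if it is available; otherwise it moves forward and parks in the first available later spot, if any (if none, it fails to park). A parking function of $1,\ldots,n$ is a sequence of preferences $(a_1,\ldots,a_n)$ such that all $n$ cars are able to park. A car is lucky if it parks in its preferred spot. The random parking function is chosen uniformly from all parking functions of $1,\ldots,n$, and $E$ denotes expectation. -}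

module Defs where

open import Data.Fin using (Fin; zero; suc; _≟_)
open import Data.Fin.Subset using (Subset; inside; outside; ⊥)
open import Data.Integer using (+_)
open import Data.List using (List; []; _∷_; allFin; applyUpTo; cartesianProductWith; filter; foldr; length; map; upTo)
open import Data.Maybe using (Maybe; just; nothing; maybe; Is-just)
import Data.Maybe as Maybe
open import Data.Maybe.Properties using (≡-dec)
open import Data.Maybe.Relation.Unary.Any using () renaming (dec to anyᵐ?)
open import Data.Nat using (ℕ; zero; suc)
import Data.Nat as ℕ
open import Data.Nat.GeneralisedArithmetic using (fold)
open import Data.Nat.Properties using (m^n≢0)
open import Data.Rational using (ℚ; 0ℚ; 1ℚ; _+_; _*_; _-_; _/_)
open import Data.Unit using (tt)
open import Data.Vec using (Vec; []; _∷_; _[_]≔_; count; lookup)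
import Data.Vec as Vec
open import Data.Vec.Relation.Unary.All using (All; all?)
open import Relation.Binary.PropositionalEquality using (_≡_)
open import Relation.Nullary using (Dec; yes)

-- Spots are numbered from 0, so spot i of the street is the element i - 1 of
-- Fin n.  A subset of Fin n records the occupied spots.

firstFree : ∀ {n} → Subset n → Fin n → Maybe (Fin n)
firstFree (_ ∷ occ)            (suc p) = Maybe.map suc (firstFree occ p)
firstFree (outside ∷ _)        zero    = just zero
firstFree (inside ∷ [])        zero    = nothing
firstFree (inside ∷ (b ∷ occ)) zero    = Maybe.map suc (firstFree (b ∷ occ) zero)

-- The spot taken by each car in order of arrival; nothing for a car that fails
-- to park, which leaves the street unchanged.
park : ∀ {n k} → Subset n → Vec (Fin n) k → Vec (Maybe (Fin n)) k
park occ []       = []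
park occ (a ∷ as) =
  let s = firstFree occ a
  in s ∷ park (maybe (λ q → occ [ q ]≔ inside) occ s) as

outcome : ∀ {n} → Vec (Fin n) n → Vec (Maybe (Fin n)) n
outcome = park ⊥

IsParkingFunction : ∀ {n} → Vec (Fin n) n → Set
IsParkingFunction a = All Is-just (outcome a)

isParkingFunction? : ∀ {n} (a : Vec (Fin n) n) → Dec (IsParkingFunction a)
isParkingFunction? a = all? (anyᵐ? (λ _ → yes tt)) (outcome a)

IsLucky : ∀ {n} → Vec (Fin n) n → Fin n → Set
IsLucky a i = lookup (outcome a) i ≡ just (lookup a i)

isLucky? : ∀ {n} (a : Vec (Fin n) n) (i : Fin n) → Dec (IsLucky a i)
isLucky? a i = ≡-dec _≟_ (lookup (outcome a) i) (just (lookup a i))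

luckyCars : ∀ {n} → Vec (Fin n) n → ℕ
luckyCars {n} a = count (isLucky? a) (Vec.allFin n)

sequences : ∀ n k → List (Vec (Fin n) k)
sequences n zero    = [] ∷ []
sequences n (suc k) = cartesianProductWith _∷_ (allFin n) (sequences n k)

parkingFunctions : ∀ n → List (Vec (Fin n) n)
parkingFunctions n = filter isParkingFunction? (sequences n n)

ι : ℕ → ℚ
ι k = + k / 1

-- Expectation of X under the uniform distribution on a duplicate-free list of
-- outcomes.  The value on the empty list is a junk value, never reached for
-- parkingFunctions n: the preferences 1, …, n always park.
𝔼 : ∀ {A : Set} → List A → (A → ℚ) → ℚ
𝔼 []            X = 0ℚ
𝔼 xs@(_ ∷ rest) X = foldr _+_ 0ℚ (map X xs) * (+ 1 / suc (length rest))

-- x (x - 1) ⋯ (x - (ℓ - 1))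
fallingFactorial : ℚ → ℕ → ℚ
fallingFactorial x ℓ = foldr _*_ 1ℚ (map (λ j → x - ι j) (upTo ℓ))

-- Polynomials over ℚ as coefficient lists, constant term first; trailing zeros
-- are allowed.
Poly : Set
Poly = List ℚ

eval : Poly → ℚ → ℚ
eval []      x = 0ℚ
eval (c ∷ p) x = c + x * eval p x

infixl 6 _⊕_
infixl 7 _·_ _⊗_

_⊕_ : Poly → Poly → Poly
[]      ⊕ q       = q
(c ∷ p) ⊕ []      = c ∷ p
(c ∷ p) ⊕ (d ∷ q) = (c + d) ∷ (p ⊕ q)

_·_ : ℚ → Poly → Poly
c · p = map (c *_) p

_⊗_ : Poly → Poly → Poly
[]      ⊗ q = []
(c ∷ p) ⊗ q = (c · q) ⊕ (0ℚ ∷ (p ⊗ q))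

-- weighted k (c₀ ∷ c₁ ∷ …) = k c₀ ∷ (k + 1) c₁ ∷ …
weighted : ℕ → Poly → Poly
weighted k []      = []
weighted k (c ∷ p) = (ι k * c) ∷ weighted (suc k) p

derivative : Poly → Poly
derivative []      = []
derivative (_ ∷ p) = weighted 1 p

iteratedDerivative : ℕ → Poly → Poly
iteratedDerivative ℓ p = fold p derivative ℓ

-- (n + 2 - i) x + (i - 1)
linearFactor : ℕ → ℕ → Poly
linearFactor n i = (ι i - 1ℚ) ∷ (ι (n ℕ.+ 2) - ι i) ∷ []

-- The product runs over i = 1, …, n.
f : ℕ → Poly
f n = (+ 1 / suc n) · foldr _⊗_ (1ℚ ∷ []) (map (linearFactor n) (applyUpTo suc n))

1/[1+n]^ : ℕ → ℕ → ℚ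
1/[1+n]^ n k = _/_ (+ 1) (suc n ℕ.^ k) {{m^n≢0 (suc n) k}}

{-# OPTIONS --safe #-}
-- Close the street into a circle with one extra spot n + 1.  With s of the n + 1
-- spots occupied, every arriving car parks, and it is lucky for exactly n + 1 - s
-- of its n + 1 preferences; so over all (n + 1)ⁿ circular preference sequences the
-- generating function of the number of lucky cars is ∏ ((n + 2 - i) x + (i - 1)).
-- By rotation symmetry the sequences leaving a given spot free contribute a
-- fraction 1/(n + 1) of it, which is f, and those leaving the extra spot free are
-- the parking functions.  Comparing ℓ-th derivatives at 1, and values at 1 to
-- count the parking functions, gives the factorial moments.
module Submission where

open import Defs
open import Algebra.Bundles using (CommutativeRing)
open import Data.Bool using (Bool; true; false; if_then_else_; not; _∨_)
open import Data.Bool.Properties using (∨-zeroʳ)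
open import Data.Empty using (⊥-elim)
open import Data.Fin using (Fin; zero; suc; toℕ; fromℕ; inject₁; _≟_)
open import Data.Fin.Induction using (<-weakInduction)
open import Data.Fin.Permutation using (Permutation′; permutation)
open import Data.Fin.Properties using (toℕ<n; toℕ-inject₁; fromℕ≢inject₁; inject₁-injective)
open import Data.Fin.Relation.Unary.Top using (view; view-fromℕ; view-inject₁; ‵fromℕ; ‵inject₁)
open import Data.Fin.Subset using (Subset; inside; outside; ⊥)
open import Data.Integer using () renaming (+_ to pos)
import Data.Integer as ℤ
import Data.Integer.Properties as ℤₚ
open import Data.List using (List; []; _∷_; _++_; applyUpTo; cartesianProductWith; filter; foldr; length; map; tabulate)
open import Data.List.Properties using (map-applyUpTo)
open import Data.Maybe using (Maybe; just; nothing; maybe; maybe′; Is-just)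
import Data.Maybe as Maybe
open import Data.Maybe.Properties using (≡-dec)
open import Data.Maybe.Relation.Unary.Any using () renaming (dec to anyᵐ?)
open import Data.Nat using (ℕ; zero; suc; pred; _≤_; _∸_; s≤s)
import Data.Nat as ℕ
import Data.Nat.Properties as ℕₚ
open import Data.Product using (∃; _,_)
open import Data.Rational using (ℚ; 0ℚ; 1ℚ; _+_; _*_; _-_; _/_; toℚᵘ)
import Data.Rational.Properties as ℚₚ
open import Data.Rational.Solver using (module +-*-Solver)
open import Data.Rational.Unnormalised using (mkℚᵘ; *≡*)
import Data.Rational.Unnormalised as ℚᵘ
import Data.Rational.Unnormalised.Properties as ℚᵘₚ
open import Data.Sum using (_⊎_; inj₁; inj₂)
open import Data.Unit using (tt)
open import Data.Vec using (Vec; []; _∷_; _[_]≔_; count; lookup)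
import Data.Vec as Vec
open import Data.Vec.Properties using (lookup∘updateAt; lookup∘updateAt′; lookup-replicate)
open import Data.Vec.Relation.Unary.All using (All; all?)
open import Function using (_∘_; case_of_; id; mk⇔)
open import Relation.Binary.PropositionalEquality using (_≡_; _≗_; refl; sym; trans; cong; cong₂; subst; module ≡-Reasoning)
open import Relation.Nullary using (Dec; does; yes; no)
open import Relation.Nullary.Decidable using (does-⇔; dec-true; dec-false)
open import Relation.Unary using (Decidable)

open import Algebra.Properties.Semiring.Sum (CommutativeRing.semiring ℚₚ.+-*-commutativeRing)
  using (sum; sum-cong-≗; sum-init-last; sum-permute; ∑-comm; *-distribʳ-sum)
open +-*-Solver using (solve; con; _:=_; _:+_; _:*_; _:-_)

private variable
  m n k : ℕ
  A B C : Set

-- The embedding of ℕ into ℚ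

-- `ι k` is stored in lowest terms; passing to unnormalised fractions lets the arithmetic of `ι` be
-- checked on numerators and denominators directly.
toℚᵘ-ι : ∀ k → toℚᵘ (ι k) ℚᵘ.≃ mkℚᵘ (pos k) 0
toℚᵘ-ι k = ℚₚ.toℚᵘ-fromℚᵘ (mkℚᵘ (pos k) 0)

ι-injective : ∀ {j k} → ι j ≡ ι k → j ≡ k
ι-injective {j} {k} eq with ℚₚ./-injective-≃ (mkℚᵘ (pos j) 0) (mkℚᵘ (pos k) 0) eq
... | *≡* e = ℤₚ.+-injective (ℤₚ.*-cancelʳ-≡ (pos j) (pos k) (pos 1) e)

ι-+ : ∀ j k → ι (j ℕ.+ k) ≡ ι j + ι k
ι-+ j k = ℚₚ.toℚᵘ-injective (begin
  toℚᵘ (ι (j ℕ.+ k))            ≈⟨ toℚᵘ-ι (j ℕ.+ k) ⟩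
  mkℚᵘ (pos (j ℕ.+ k)) 0          ≈⟨ *≡* (cong (ℤ._* pos 1) (cong₂ ℤ._+_ (sym (ℤₚ.*-identityʳ (pos j))) (sym (ℤₚ.*-identityʳ (pos k))))) ⟩
  mkℚᵘ (pos j) 0 ℚᵘ.+ mkℚᵘ (pos k) 0 ≈⟨ ℚᵘₚ.+-cong (toℚᵘ-ι j) (toℚᵘ-ι k) ⟨
  toℚᵘ (ι j) ℚᵘ.+ toℚᵘ (ι k)    ≈⟨ ℚₚ.toℚᵘ-homo-+ (ι j) (ι k) ⟨
  toℚᵘ (ι j + ι k)              ∎)
  where open ℚᵘₚ.≃-Reasoning

ι-suc : ∀ k → ι (suc k) ≡ 1ℚ + ι k
ι-suc = ι-+ 1

ι-* : ∀ j k → ι (j ℕ.* k) ≡ ι j * ι k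
ι-* zero    k = sym (ℚₚ.*-zeroˡ (ι k))
ι-* (suc j) k = begin
  ι (k ℕ.+ j ℕ.* k)   ≡⟨ ι-+ k (j ℕ.* k) ⟩
  ι k + ι (j ℕ.* k)   ≡⟨ cong (ι k +_) (ι-* j k) ⟩
  ι k + ι j * ι k     ≡⟨ solve 2 (λ a b → b :+ a :* b := (con 1ℚ :+ a) :* b) refl (ι j) (ι k) ⟩
  (1ℚ + ι j) * ι k    ≡⟨ cong (_* ι k) (ι-suc j) ⟨
  ι (suc j) * ι k     ∎
  where open ≡-Reasoning

ι-inverse : ∀ k .{{_ : ℕ.NonZero k}} → (pos 1 / k) * ι k ≡ 1ℚ
ι-inverse k@(suc k-1) = ℚₚ.toℚᵘ-injective (begin
  toℚᵘ ((pos 1 / k) * ι k)            ≈⟨ ℚₚ.toℚᵘ-homo-* (pos 1 / k) (ι k) ⟩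
  toℚᵘ (pos 1 / k) ℚᵘ.* toℚᵘ (ι k)    ≈⟨ ℚᵘₚ.*-cong (ℚₚ.toℚᵘ-fromℚᵘ (mkℚᵘ (pos 1) k-1)) (toℚᵘ-ι k) ⟩
  mkℚᵘ (pos 1) k-1 ℚᵘ.* mkℚᵘ (pos k) 0  ≈⟨ *≡* (trans (ℤₚ.*-identityʳ (pos 1 ℤ.* pos k)) (cong (λ d → pos 1 ℤ.* pos (suc d)) (sym (ℕₚ.*-identityʳ k-1)))) ⟩
  toℚᵘ 1ℚ                           ∎)
  where open ℚᵘₚ.≃-Reasoning

-- Sums over lists

total : List A → (A → ℚ) → ℚ
total xs X = foldr _+_ 0ℚ (map X xs)

total-cong : ∀ (xs : List A) {X Y : A → ℚ} → X ≗ Y → total xs X ≡ total xs Y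
total-cong []       X≗Y = refl
total-cong (x ∷ xs) X≗Y = cong₂ _+_ (X≗Y x) (total-cong xs X≗Y)

total-zero : ∀ (xs : List A) → total xs (λ _ → 0ℚ) ≡ 0ℚ
total-zero []       = refl
total-zero (x ∷ xs) = trans (ℚₚ.+-identityˡ _) (total-zero xs)

total-one : ∀ (xs : List A) → total xs (λ _ → 1ℚ) ≡ ι (length xs)
total-one []       = refl
total-one (x ∷ xs) = trans (cong (1ℚ +_) (total-one xs)) (sym (ι-suc (length xs)))

total-++ : ∀ (xs ys : List A) X → total (xs ++ ys) X ≡ total xs X + total ys X
total-++ []       ys X = sym (ℚₚ.+-identityˡ _)
total-++ (x ∷ xs) ys X = trans (cong (X x +_) (total-++ xs ys X)) (sym (ℚₚ.+-assoc (X x) (total xs X) (total ys X)))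

total-map : ∀ (g : A → B) xs X → total (map g xs) X ≡ total xs (X ∘ g)
total-map g []       X = refl
total-map g (x ∷ xs) X = cong (X (g x) +_) (total-map g xs X)

total-tabulate : ∀ (g : Fin n → A) X → total (tabulate g) X ≡ sum (X ∘ g)
total-tabulate {n = zero}  g X = refl
total-tabulate {n = suc n} g X = cong (X (g zero) +_) (total-tabulate (g ∘ suc) X)

total-cartesianProductWith : ∀ (g : A → B → C) xs ys X →
  total (cartesianProductWith g xs ys) X ≡ total xs (λ x → total ys (X ∘ g x))
total-cartesianProductWith g []       ys X = refl
total-cartesianProductWith g (x ∷ xs) ys X = begin
  total (map (g x) ys ++ cartesianProductWith g xs ys) X
    ≡⟨ total-++ (map (g x) ys) _ X ⟩
  total (map (g x) ys) X + total (cartesianProductWith g xs ys) X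
    ≡⟨ cong₂ _+_ (total-map (g x) ys X) (total-cartesianProductWith g xs ys X) ⟩
  total ys (X ∘ g x) + total xs (λ x → total ys (X ∘ g x)) ∎
  where open ≡-Reasoning

total-filter : ∀ {P : A → Set} (P? : Decidable P) xs X →
  total (filter P? xs) X ≡ total xs (λ x → if does (P? x) then X x else 0ℚ)
total-filter P? []       X = refl
total-filter P? (x ∷ xs) X with does (P? x)
... | true  = cong (X x +_) (total-filter P? xs X)
... | false = trans (total-filter P? xs X) (sym (ℚₚ.+-identityˡ _))

sum-const : ∀ n x → sum {n} (λ _ → x) ≡ ι n * x
sum-const zero    x = sym (ℚₚ.*-zeroˡ x)
sum-const (suc n) x = begin
  x + sum {n} (λ _ → x)  ≡⟨ cong (x +_) (sum-const n x) ⟩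
  x + ι n * x            ≡⟨ solve 2 (λ a x → x :+ a :* x := (con 1ℚ :+ a) :* x) refl (ι n) x ⟩
  (1ℚ + ι n) * x         ≡⟨ cong (_* x) (ι-suc n) ⟨
  ι (suc n) * x          ∎
  where open ≡-Reasoning

-- A nonzero `N` rules out the empty list, so the junk value of `𝔼` never enters.
𝔼-total : ∀ (xs : List A) X N .{{_ : ℕ.NonZero N}} → length xs ≡ N →
  𝔼 xs X ≡ (pos 1 / N) * total xs X
𝔼-total (x ∷ xs) X _ refl = ℚₚ.*-comm (total (x ∷ xs) X) _

-- Polynomials as linear functionals on sequences

-- c₀ + c₁ x + ⋯ sends h to c₀ h(0) + c₁ h(1) + ⋯; thus p(x₀) is the value on
-- h(k) = x₀ᵏ, multiplication by x is the shift of h, and the ℓ-th derivative at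
-- 1 is the value on the falling factorials.
⟪_,_⟫ : Poly → (ℕ → ℚ) → ℚ
⟪ []    , h ⟫ = 0ℚ
⟪ c ∷ p , h ⟫ = c * h 0 + ⟪ p , h ∘ suc ⟫

⟪,⟫-cong : ∀ p {h g : ℕ → ℚ} → h ≗ g → ⟪ p , h ⟫ ≡ ⟪ p , g ⟫
⟪,⟫-cong []      h≗g = refl
⟪,⟫-cong (c ∷ p) h≗g = cong₂ _+_ (cong (c *_) (h≗g 0)) (⟪,⟫-cong p (h≗g ∘ suc))

⟪⊕,⟫ : ∀ p q h → ⟪ p ⊕ q , h ⟫ ≡ ⟪ p , h ⟫ + ⟪ q , h ⟫
⟪⊕,⟫ []      q       h = sym (ℚₚ.+-identityˡ _)
⟪⊕,⟫ (c ∷ p) []      h = sym (ℚₚ.+-identityʳ _)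
⟪⊕,⟫ (c ∷ p) (d ∷ q) h = begin
  (c + d) * h 0 + ⟪ p ⊕ q , h ∘ suc ⟫
    ≡⟨ cong ((c + d) * h 0 +_) (⟪⊕,⟫ p q (h ∘ suc)) ⟩
  (c + d) * h 0 + (⟪ p , h ∘ suc ⟫ + ⟪ q , h ∘ suc ⟫)
    ≡⟨ solve 5 (λ c d x y z → (c :+ d) :* x :+ (y :+ z) := (c :* x :+ y) :+ (d :* x :+ z)) refl c d (h 0) ⟪ p , h ∘ suc ⟫ ⟪ q , h ∘ suc ⟫ ⟩
  (c * h 0 + ⟪ p , h ∘ suc ⟫) + (d * h 0 + ⟪ q , h ∘ suc ⟫) ∎
  where open ≡-Reasoning

⟪·,⟫ : ∀ c p h → ⟪ c · p , h ⟫ ≡ c * ⟪ p , h ⟫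
⟪·,⟫ c []      h = sym (ℚₚ.*-zeroʳ c)
⟪·,⟫ c (d ∷ p) h = begin
  c * d * h 0 + ⟪ c · p , h ∘ suc ⟫    ≡⟨ cong (c * d * h 0 +_) (⟪·,⟫ c p (h ∘ suc)) ⟩
  c * d * h 0 + c * ⟪ p , h ∘ suc ⟫    ≡⟨ solve 4 (λ c d x y → c :* d :* x :+ c :* y := c :* (d :* x :+ y)) refl c d (h 0) ⟪ p , h ∘ suc ⟫ ⟩
  c * (d * h 0 + ⟪ p , h ∘ suc ⟫)      ∎
  where open ≡-Reasoning

⟪linear⊗,⟫ : ∀ a b p h → ⟪ (a ∷ b ∷ []) ⊗ p , h ⟫ ≡ a * ⟪ p , h ⟫ + b * ⟪ p , h ∘ suc ⟫
⟪linear⊗,⟫ a b p h = begin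
  ⟪ a · p ⊕ (0ℚ ∷ b · p ⊕ (0ℚ ∷ [])) , h ⟫
    ≡⟨ ⟪⊕,⟫ (a · p) _ h ⟩
  ⟪ a · p , h ⟫ + (0ℚ * h 0 + ⟪ b · p ⊕ (0ℚ ∷ []) , h ∘ suc ⟫)
    ≡⟨ cong (λ x → ⟪ a · p , h ⟫ + (0ℚ * h 0 + x)) (⟪⊕,⟫ (b · p) _ (h ∘ suc)) ⟩
  ⟪ a · p , h ⟫ + (0ℚ * h 0 + (⟪ b · p , h ∘ suc ⟫ + (0ℚ * h 1 + 0ℚ)))
    ≡⟨ cong₂ (λ x y → x + (0ℚ * h 0 + (y + (0ℚ * h 1 + 0ℚ)))) (⟪·,⟫ a p h) (⟪·,⟫ b p (h ∘ suc)) ⟩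
  a * ⟪ p , h ⟫ + (0ℚ * h 0 + (b * ⟪ p , h ∘ suc ⟫ + (0ℚ * h 1 + 0ℚ)))
    ≡⟨ solve 4 (λ x y u v → x :+ (con 0ℚ :* u :+ (y :+ (con 0ℚ :* v :+ con 0ℚ))) := x :+ y) refl (a * ⟪ p , h ⟫) (b * ⟪ p , h ∘ suc ⟫) (h 0) (h 1) ⟩
  a * ⟪ p , h ⟫ + b * ⟪ p , h ∘ suc ⟫ ∎
  where open ≡-Reasoning

⟪weighted,⟫ : ∀ j p h → ⟪ weighted j p , h ⟫ ≡ ⟪ p , (λ k → ι (k ℕ.+ j) * h k) ⟫
⟪weighted,⟫ j []      h = refl
⟪weighted,⟫ j (c ∷ p) h = cong₂ _+_
  (solve 3 (λ x c y → x :* c :* y := c :* (x :* y)) refl (ι j) c (h 0))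
  (trans (⟪weighted,⟫ (suc j) p (h ∘ suc))
         (⟪,⟫-cong p (λ k → cong (λ i → ι i * h (suc k)) (ℕₚ.+-suc k j))))

-- The term x^k becomes k x^(k-1); at k = 0 the factor `ι 0` vanishes, so the value of `pred 0` is
-- harmless.
⟪derivative,⟫ : ∀ p h → ⟪ derivative p , h ⟫ ≡ ⟪ p , (λ k → ι k * h (pred k)) ⟫
⟪derivative,⟫ []      h = refl
⟪derivative,⟫ (c ∷ p) h = begin
  ⟪ weighted 1 p , h ⟫
    ≡⟨ ⟪weighted,⟫ 1 p h ⟩
  ⟪ p , (λ k → ι (k ℕ.+ 1) * h k) ⟫
    ≡⟨ ⟪,⟫-cong p (λ k → cong (λ i → ι i * h k) (ℕₚ.+-comm k 1)) ⟩
  ⟪ p , (λ k → ι (suc k) * h k) ⟫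
    ≡⟨ solve 3 (λ c x y → y := c :* (con 0ℚ :* x) :+ y) refl c (h 0) _ ⟩
  c * (0ℚ * h 0) + ⟪ p , (λ k → ι (suc k) * h k) ⟫ ∎
  where open ≡-Reasoning

-- Derivatives at 1 and falling factorials

eval-1 : ∀ p → eval p 1ℚ ≡ ⟪ p , (λ _ → 1ℚ) ⟫
eval-1 []      = refl
eval-1 (c ∷ p) = cong₂ _+_ (sym (ℚₚ.*-identityʳ c)) (trans (ℚₚ.*-identityˡ _) (eval-1 p))

-- `iteratedDerivative` puts each new derivative outermost, whereas the induction in
-- `eval-iteratedDerivative` strips the innermost one.
iteratedDerivative-derivative : ∀ ℓ p →
  iteratedDerivative ℓ (derivative p) ≡ derivative (iteratedDerivative ℓ p)
iteratedDerivative-derivative zero    p = refl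
iteratedDerivative-derivative (suc ℓ) p = cong derivative (iteratedDerivative-derivative ℓ p)

foldr-applyUpTo-cong : ∀ (_•_ : A → B → B) e {g h : ℕ → A} → g ≗ h → ∀ k →
  foldr _•_ e (applyUpTo g k) ≡ foldr _•_ e (applyUpTo h k)
foldr-applyUpTo-cong _•_ e g≗h zero    = refl
foldr-applyUpTo-cong _•_ e g≗h (suc k) = cong₂ _•_ (g≗h 0) (foldr-applyUpTo-cong _•_ e (g≗h ∘ suc) k)

-- Splitting off the first factor, not the last, matches the effect of one derivative: a factor k in
-- front of a function of k - 1.
fallingFactorial-suc : ∀ x ℓ → fallingFactorial x (suc ℓ) ≡ x * fallingFactorial (x - 1ℚ) ℓ
fallingFactorial-suc x ℓ = cong₂ _*_ (solve 1 (λ x → x :- con 0ℚ := x) refl x) (begin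
  foldr _*_ 1ℚ (map (λ j → x - ι j) (applyUpTo suc ℓ))
    ≡⟨ cong (foldr _*_ 1ℚ) (map-applyUpTo suc (λ j → x - ι j) ℓ) ⟩
  foldr _*_ 1ℚ (applyUpTo (λ j → x - ι (suc j)) ℓ)
    ≡⟨ foldr-applyUpTo-cong _*_ 1ℚ (λ j → trans (cong (x -_) (ι-suc j))
         (solve 2 (λ x y → x :- (con 1ℚ :+ y) := x :- con 1ℚ :- y) refl x (ι j))) ℓ ⟩
  foldr _*_ 1ℚ (applyUpTo (λ j → x - 1ℚ - ι j) ℓ)
    ≡⟨ cong (foldr _*_ 1ℚ) (map-applyUpTo id (λ j → x - 1ℚ - ι j) ℓ) ⟨
  fallingFactorial (x - 1ℚ) ℓ ∎)
  where open ≡-Reasoning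

eval-iteratedDerivative : ∀ ℓ p →
  eval (iteratedDerivative ℓ p) 1ℚ ≡ ⟪ p , (λ k → fallingFactorial (ι k) ℓ) ⟫
eval-iteratedDerivative zero    p = eval-1 p
eval-iteratedDerivative (suc ℓ) p = begin
  eval (derivative (iteratedDerivative ℓ p)) 1ℚ
    ≡⟨ cong (λ q → eval q 1ℚ) (iteratedDerivative-derivative ℓ p) ⟨
  eval (iteratedDerivative ℓ (derivative p)) 1ℚ
    ≡⟨ eval-iteratedDerivative ℓ (derivative p) ⟩
  ⟪ derivative p , (λ k → fallingFactorial (ι k) ℓ) ⟫
    ≡⟨ ⟪derivative,⟫ p _ ⟩
  ⟪ p , (λ k → ι k * fallingFactorial (ι (pred k)) ℓ) ⟫
    ≡⟨ ⟪,⟫-cong p step ⟩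
  ⟪ p , (λ k → fallingFactorial (ι k) (suc ℓ)) ⟫ ∎
  where
  open ≡-Reasoning
  step : ∀ k → ι k * fallingFactorial (ι (pred k)) ℓ ≡ fallingFactorial (ι k) (suc ℓ)
  step zero    = trans (ℚₚ.*-zeroˡ (fallingFactorial 0ℚ ℓ))
    (sym (trans (fallingFactorial-suc 0ℚ ℓ) (ℚₚ.*-zeroˡ (fallingFactorial (0ℚ - 1ℚ) ℓ))))
  step (suc k) = trans
    (cong (λ x → ι (suc k) * fallingFactorial x ℓ)
      (trans (solve 1 (λ x → x := con 1ℚ :+ x :- con 1ℚ) refl (ι k)) (cong (_- 1ℚ) (sym (ι-suc k)))))
    (sym (fallingFactorial-suc (ι (suc k)) ℓ))

-- The circular street

-- A circle of n + 1 spots. Being a function, it is rotated by composition with `rotate`.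
Occupancy : ℕ → Set
Occupancy n = Fin (suc n) → Bool

rotate : Fin (suc n) → Fin (suc n)
rotate i with view i
... | ‵fromℕ     = zero
... | ‵inject₁ j = suc j

unrotate : Fin (suc n) → Fin (suc n)
unrotate {n} zero    = fromℕ n
unrotate     (suc i) = inject₁ i

rotate-inject₁ : ∀ (i : Fin n) → rotate (inject₁ i) ≡ suc i
rotate-inject₁ i rewrite view-inject₁ i = refl

rotate-unrotate : ∀ (i : Fin (suc n)) → rotate (unrotate i) ≡ i
rotate-unrotate {n} zero    rewrite view-fromℕ n = refl
rotate-unrotate     (suc i) = rotate-inject₁ i

unrotate-rotate : ∀ (i : Fin (suc n)) → unrotate (rotate i) ≡ i
unrotate-rotate i with view i
... | ‵fromℕ     = refl
... | ‵inject₁ j = refl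

rotation : ∀ n → Permutation′ (suc n)
rotation n = permutation rotate unrotate rotate-unrotate unrotate-rotate

-- Rotations take the last spot to every spot: first to `zero`, then upwards one spot at a time.
rotate-induction : ∀ (P : Fin (suc n) → Set) → (∀ i → P i → P (rotate i)) → P (fromℕ n) → ∀ i → P i
rotate-induction {n} P step base = <-weakInduction P
  (subst P (rotate-unrotate zero) (step (fromℕ n) base))
  (λ i → subst P (rotate-inject₁ i) ∘ step (inject₁ i))

does-≟-injective : ∀ (g : Fin m → Fin n) → (∀ {i j} → g i ≡ g j → i ≡ j) →
  ∀ i j → does (g i ≟ g j) ≡ does (i ≟ j)
does-≟-injective g inj i j = does-⇔ (mk⇔ inj (cong g)) (g i ≟ g j) (i ≟ j)

rotate-injective : ∀ {i j : Fin (suc n)} → rotate i ≡ rotate j → i ≡ j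
rotate-injective {i = i} {j} eq = trans (sym (unrotate-rotate i)) (trans (cong unrotate eq) (unrotate-rotate j))

-- Counting occupied and free spots

occupy : ∀ {m} → (Fin m → Bool) → Fin m → Fin m → Bool
occupy c q i = does (i ≟ q) ∨ c i

occupied : ∀ {m} → (Fin m → Bool) → ℕ
occupied {zero}  c = 0
occupied {suc m} c = if c zero then suc (occupied (c ∘ suc)) else occupied (c ∘ suc)

occupied-empty : ∀ m → occupied {m} (λ _ → false) ≡ 0
occupied-empty zero    = refl
occupied-empty (suc m) = occupied-empty m

occupied-occupy : ∀ (c : Fin m → Bool) q → c q ≡ false → occupied (occupy c q) ≡ suc (occupied c)
occupied-occupy c zero    eq rewrite eq = refl
occupied-occupy c (suc q) eq with c zero
... | true  = cong suc (occupied-occupy (c ∘ suc) q eq)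
... | false = occupied-occupy (c ∘ suc) q eq

free-or-full : ∀ (c : Fin m → Bool) → ∃ (λ j → c j ≡ false) ⊎ occupied c ≡ m
free-or-full {zero}  c = inj₂ refl
free-or-full {suc m} c with c zero in eq | free-or-full (c ∘ suc)
... | false | _               = inj₁ (zero , eq)
... | true  | inj₁ (j , free) = inj₁ (suc j , free)
... | true  | inj₂ full       = inj₂ (cong suc full)

-- With u for an unlucky and v for a lucky preference, this produces the two coefficients of a
-- linear factor; with u = 0 it counts free spots.
sum-if : ∀ (c : Fin m → Bool) u v →
  sum (λ i → if c i then u else v) ≡ ι (occupied c) * u + (ι m - ι (occupied c)) * v
sum-if {zero}  c u v = solve 2 (λ u v → con 0ℚ := con 0ℚ :* u :+ (con 0ℚ :- con 0ℚ) :* v) refl u v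
sum-if {suc m} c u v with c zero
... | true  = begin
  u + sum (λ i → if c (suc i) then u else v)
    ≡⟨ cong (u +_) (sum-if (c ∘ suc) u v) ⟩
  u + (ι s * u + (ι m - ι s) * v)
    ≡⟨ solve 4 (λ u v s m → u :+ (s :* u :+ (m :- s) :* v) := (con 1ℚ :+ s) :* u :+ (con 1ℚ :+ m :- (con 1ℚ :+ s)) :* v) refl u v (ι s) (ι m) ⟩
  (1ℚ + ι s) * u + (1ℚ + ι m - (1ℚ + ι s)) * v
    ≡⟨ cong₂ (λ x y → x * u + (y - x) * v) (ι-suc s) (ι-suc m) ⟨
  ι (suc s) * u + (ι (suc m) - ι (suc s)) * v ∎
  where
  open ≡-Reasoning
  s = occupied (c ∘ suc)
... | false = begin
  v + sum (λ i → if c (suc i) then u else v)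
    ≡⟨ cong (v +_) (sum-if (c ∘ suc) u v) ⟩
  v + (ι s * u + (ι m - ι s) * v)
    ≡⟨ solve 4 (λ u v s m → v :+ (s :* u :+ (m :- s) :* v) := s :* u :+ (con 1ℚ :+ m :- s) :* v) refl u v (ι s) (ι m) ⟩
  ι s * u + (1ℚ + ι m - ι s) * v
    ≡⟨ cong (λ y → ι s * u + (y - ι s) * v) (ι-suc m) ⟨
  ι s * u + (ι (suc m) - ι s) * v ∎
  where
  open ≡-Reasoning
  s = occupied (c ∘ suc)

-- Parking on the circle

-- The first argument bounds the number of moves; once it is spent, the current spot is returned
-- unexamined.
seek : ℕ → Occupancy n → Fin (suc n) → Fin (suc n)
seek zero    c p = p
seek (suc d) c p = if c p then seek d c (rotate p) else p

-- From any spot, n moves reach all n + 1 spots, so a free one is found if there is any.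
nextFree : Occupancy n → Fin (suc n) → Fin (suc n)
nextFree {n} = seek n

seek-at-free : ∀ d (c : Occupancy n) p → c p ≡ false → seek d c p ≡ p
seek-at-free zero    c p eq = refl
seek-at-free (suc d) c p eq rewrite eq = refl

-- The rule is the same at every spot, so it commutes with rotation; `c′` is the street `c` in
-- rotated coordinates.
seek-rotate : ∀ d {c c′ : Occupancy n} → c′ ≗ c ∘ rotate → ∀ p → seek d c (rotate p) ≡ rotate (seek d c′ p)
seek-rotate zero    eq p = refl
seek-rotate (suc d) {c} {c′} eq p rewrite eq p with c (rotate p)
... | true  = seek-rotate d eq (rotate p)
... | false = refl

-- With the last spot free the drive never wraps around, and the bound on d lets it get as far as
-- that spot.
seek-free : ∀ d (c : Occupancy n) → c (fromℕ n) ≡ false → ∀ p → n ≤ toℕ p ℕ.+ d → c (seek d c p) ≡ false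
seek-free zero c free p n≤ with view p
... | ‵fromℕ     = free
... | ‵inject₁ i = ⊥-elim (ℕₚ.<⇒≱ (toℕ<n i) (subst (_ ≤_) (trans (ℕₚ.+-identityʳ _) (toℕ-inject₁ i)) n≤))
seek-free {n} (suc d) c free p n≤ with c p in eq
... | false = eq
... | true with view p
...   | ‵fromℕ     = case trans (sym eq) free of λ ()
...   | ‵inject₁ i = seek-free d c free (suc i)
  (subst (n ≤_) (trans (ℕₚ.+-suc _ d) (cong (λ t → suc (t ℕ.+ d)) (toℕ-inject₁ i))) n≤)

-- Rotating a free spot to the last position reduces to `seek-free`.
nextFree-free : ∀ j (c : Occupancy n) → c j ≡ false → ∀ p → c (nextFree c p) ≡ false
nextFree-free {n} = rotate-induction (λ j → ∀ c → c j ≡ false → ∀ p → c (nextFree c p) ≡ false)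
  (λ j ih c free p → trans
    (cong c (trans (cong (nextFree c) (sym (rotate-unrotate p))) (seek-rotate n (λ _ → refl) (unrotate p))))
    (ih (c ∘ rotate) free (unrotate p)))
  (λ c free p → seek-free n c free p (ℕₚ.m≤n+m n (toℕ p)))

-- An occupied preference cannot equal the free spot that is found, so luck is decided by the
-- preferred spot alone.
does-nextFree-≟ : ∀ (c : Occupancy n) j → c j ≡ false → ∀ p → does (nextFree c p ≟ p) ≡ not (c p)
does-nextFree-≟ {n} c j free p with c p in eq
... | false = dec-true (nextFree c p ≟ p) (seek-at-free n c p eq)
... | true  = dec-false (nextFree c p ≟ p) λ q≡p →
  case trans (sym eq) (trans (cong c (sym q≡p)) (nextFree-free j c free p)) of λ ()

-- Generating function of lucky cars on the circle

-- A lucky car raises the count by one, which shifts `h`; on polynomials this is multiplication by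
-- x.
shiftIf : Bool → (ℕ → ℚ) → ℕ → ℚ
shiftIf true  h = h ∘ suc
shiftIf false h = h

-- The sum of h (number of lucky cars) over the preferences of k more cars for
-- which spot j stays free.
circular : Occupancy n → ℕ → Fin (suc n) → (ℕ → ℚ) → ℚ
circular c zero    j h = if c j then 0ℚ else h 0
circular c (suc k) j h = sum λ p → circular (occupy c (nextFree c p)) k j (shiftIf (does (nextFree c p ≟ p)) h)

-- Reindexing the preferences by `rotate` carries each parking history to its rotated copy. The
-- hypothesis is pointwise because the two occupancies after a car parks are matched only pointwise.
circular-rotate : ∀ k {c c′ : Occupancy n} → c′ ≗ c ∘ rotate → ∀ j h →
  circular c k (rotate j) h ≡ circular c′ k j h
circular-rotate zero    eq j h = cong (λ b → if b then 0ℚ else h 0) (sym (eq j))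
circular-rotate {n} (suc k) {c} {c′} eq j h = trans
  (sum-permute (λ p → circular (occupy c (nextFree c p)) k (rotate j) (shiftIf (does (nextFree c p ≟ p)) h)) (rotation n))
  (sum-cong-≗ step)
  where
  step : ∀ p → circular (occupy c (nextFree c (rotate p))) k (rotate j) (shiftIf (does (nextFree c (rotate p) ≟ rotate p)) h)
             ≡ circular (occupy c′ (nextFree c′ p)) k j (shiftIf (does (nextFree c′ p ≟ p)) h)
  step p = trans
    (cong (λ q → circular (occupy c q) k (rotate j) (shiftIf (does (q ≟ rotate p)) h)) (seek-rotate n eq p))
    (trans
      (cong (λ b → circular (occupy c (rotate q′)) k (rotate j) (shiftIf b h)) (does-≟-injective rotate rotate-injective q′ p))
      (circular-rotate k
        (λ i → cong₂ _∨_ (sym (does-≟-injective rotate rotate-injective i q′)) (eq i)) j (shiftIf (does (q′ ≟ p)) h)))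
    where q′ = nextFree c′ p

-- The empty circle is invariant under rotation.
circular-const : ∀ k h (j : Fin (suc n)) → circular (λ _ → false) k j h ≡ circular (λ _ → false) k (fromℕ n) h
circular-const {n} k h = rotate-induction (λ j → circular (λ _ → false) k j h ≡ circular (λ _ → false) k (fromℕ n) h)
  (λ i → trans (circular-rotate k (λ _ → refl) i h)) refl

-- A taken spot is never vacated.
circular-occupied : ∀ (c : Occupancy n) k j h → c j ≡ true → circular c k j h ≡ 0ℚ
circular-occupied c zero    j h eq rewrite eq = refl
circular-occupied {n} c (suc k) j h eq = trans
  (sum-cong-≗ λ p → circular-occupied (occupy c (nextFree c p)) k j (shiftIf (does (nextFree c p ≟ p)) h)
    (trans (cong (does (j ≟ nextFree c p) ∨_) eq) (∨-zeroʳ _)))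
  (trans (sum-const (suc n) 0ℚ) (ℚₚ.*-zeroʳ (ι (suc n))))

-- The linear factors for i = s + 1, ..., s + k: the contribution of k cars arriving when s spots
-- are taken.
factors : ℕ → ℕ → ℕ → Poly
factors n s zero    = 1ℚ ∷ []
factors n s (suc k) = linearFactor n (suc s) ⊗ factors n (suc s) k

⟪factors,⟫ : ∀ n s k h → ⟪ factors n s (suc k) , h ⟫
  ≡ ι s * ⟪ factors n (suc s) k , h ⟫ + (ι (suc n) - ι s) * ⟪ factors n (suc s) k , h ∘ suc ⟫
⟪factors,⟫ n s k h = trans
  (⟪linear⊗,⟫ (ι (suc s) - 1ℚ) (ι (n ℕ.+ 2) - ι (suc s)) (factors n (suc s) k) h)
  (cong₂ (λ a b → a * ⟪ factors n (suc s) k , h ⟫ + b * ⟪ factors n (suc s) k , h ∘ suc ⟫) a≡ b≡)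
  where
  a≡ : ι (suc s) - 1ℚ ≡ ι s
  a≡ = trans (cong (_- 1ℚ) (ι-suc s)) (solve 1 (λ s → con 1ℚ :+ s :- con 1ℚ := s) refl (ι s))
  b≡ : ι (n ℕ.+ 2) - ι (suc s) ≡ ι (suc n) - ι s
  b≡ = trans
    (cong₂ _-_ (trans (cong ι (ℕₚ.+-comm n 2)) (ι-suc (suc n))) (ι-suc s))
    (solve 2 (λ n s → con 1ℚ :+ n :- (con 1ℚ :+ s) := n :- s) refl (ι (suc n)) (ι s))

-- The two coefficients of each factor add up to n + 1, the number of preferences of one car.
factors-one : ∀ n s k → ⟪ factors n s k , (λ _ → 1ℚ) ⟫ ≡ ι (suc n ℕ.^ k)
factors-one n s zero    = refl
factors-one n s (suc k) = begin
  ⟪ factors n s (suc k) , (λ _ → 1ℚ) ⟫   ≡⟨ ⟪factors,⟫ n s k _ ⟩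
  ι s * x + (ι (suc n) - ι s) * x        ≡⟨ solve 3 (λ s n x → s :* x :+ (n :- s) :* x := n :* x) refl (ι s) (ι (suc n)) x ⟩
  ι (suc n) * x                          ≡⟨ cong (ι (suc n) *_) (factors-one n (suc s) k) ⟩
  ι (suc n) * ι (suc n ℕ.^ k)            ≡⟨ ι-* (suc n) (suc n ℕ.^ k) ⟨
  ι (suc n ℕ.* suc n ℕ.^ k)              ∎
  where
  open ≡-Reasoning
  x = ⟪ factors n (suc s) k , (λ _ → 1ℚ) ⟫

-- A general `g` is needed for the induction, since `applyUpTo` composes its function with `suc` at
-- each step.
foldr-factors : ∀ n s k (g : ℕ → ℕ) → (∀ i → g i ≡ suc (s ℕ.+ i)) →
  foldr _⊗_ (1ℚ ∷ []) (map (linearFactor n) (applyUpTo g k)) ≡ factors n s k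
foldr-factors n s zero    g eq = refl
foldr-factors n s (suc k) g eq = cong₂ _⊗_
  (cong (linearFactor n) (trans (eq 0) (cong suc (ℕₚ.+-identityʳ s))))
  (foldr-factors n (suc s) k (g ∘ suc) (λ i → trans (eq (suc i)) (cong suc (ℕₚ.+-suc s i))))

-- Each history ends with n + 1 - (s + k) free spots and is counted once for each, whence the last
-- factor. The next car is unlucky for s preferences, which keep `h`, and lucky for n + 1 - s, which
-- shift it.
sum-circular : ∀ (c : Occupancy n) s k h → occupied c ≡ s → s ℕ.+ k ≤ n →
  sum (λ j → circular c k j h) ≡ ⟪ factors n s k , h ⟫ * (ι (suc n) - ι (s ℕ.+ k))
sum-circular {n} c s zero h refl s≤n = begin
  sum (λ j → if c j then 0ℚ else h 0)
    ≡⟨ sum-if c 0ℚ (h 0) ⟩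
  ι s * 0ℚ + (ι (suc n) - ι s) * h 0
    ≡⟨ solve 3 (λ s n x → s :* con 0ℚ :+ (n :- s) :* x := (con 1ℚ :* x :+ con 0ℚ) :* (n :- s)) refl (ι s) (ι (suc n)) (h 0) ⟩
  (1ℚ * h 0 + 0ℚ) * (ι (suc n) - ι s)
    ≡⟨ cong (λ t → (1ℚ * h 0 + 0ℚ) * (ι (suc n) - ι t)) (ℕₚ.+-identityʳ s) ⟨
  (1ℚ * h 0 + 0ℚ) * (ι (suc n) - ι (s ℕ.+ 0)) ∎
  where open ≡-Reasoning
sum-circular {n} c s (suc k) h refl s+1+k≤n with free-or-full c
-- A full circle would give s = n + 1, against s + (k + 1) ≤ n.
... | inj₂ full         = ⊥-elim (ℕₚ.<-irrefl full (s≤s (ℕₚ.≤-trans (ℕₚ.m≤m+n s (suc k)) s+1+k≤n)))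
... | inj₁ (j₀ , free) = begin
  sum (λ j → sum λ p → circular (occupy c (nextFree c p)) k j (shiftIf (does (nextFree c p ≟ p)) h))
    -- With the preference of the first car outermost, the induction hypothesis applies for each p.
    ≡⟨ ∑-comm (λ j p → circular (occupy c (nextFree c p)) k j (shiftIf (does (nextFree c p ≟ p)) h)) ⟩
  sum (λ p → sum λ j → circular (occupy c (nextFree c p)) k j (shiftIf (does (nextFree c p ≟ p)) h))
    ≡⟨ sum-cong-≗ step ⟩
  sum (λ p → (if c p then ⟪ P , h ⟫ else ⟪ P , h ∘ suc ⟫) * r)
    ≡⟨ *-distribʳ-sum r (λ p → if c p then ⟪ P , h ⟫ else ⟪ P , h ∘ suc ⟫) ⟨
  sum (λ p → if c p then ⟪ P , h ⟫ else ⟪ P , h ∘ suc ⟫) * r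
    ≡⟨ cong (_* r) (sum-if c ⟪ P , h ⟫ ⟪ P , h ∘ suc ⟫) ⟩
  (ι s * ⟪ P , h ⟫ + (ι (suc n) - ι s) * ⟪ P , h ∘ suc ⟫) * r
    ≡⟨ cong (_* r) (⟪factors,⟫ n s k h) ⟨
  ⟪ factors n s (suc k) , h ⟫ * r ∎
  where
  open ≡-Reasoning
  P = factors n (suc s) k
  r = ι (suc n) - ι (s ℕ.+ suc k)
  shifted : ∀ b → ⟪ P , shiftIf (not b) h ⟫ ≡ (if b then ⟪ P , h ⟫ else ⟪ P , h ∘ suc ⟫)
  shifted true  = refl
  shifted false = refl
  step : ∀ p → sum (λ j → circular (occupy c (nextFree c p)) k j (shiftIf (does (nextFree c p ≟ p)) h))
             ≡ (if c p then ⟪ P , h ⟫ else ⟪ P , h ∘ suc ⟫) * r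
  step p = begin
    sum (λ j → circular (occupy c q) k j (shiftIf (does (q ≟ p)) h))
      ≡⟨ sum-circular (occupy c q) (suc s) k _ (occupied-occupy c q (nextFree-free j₀ c free p))
           (subst (_≤ n) (ℕₚ.+-suc s k) s+1+k≤n) ⟩
    ⟪ P , shiftIf (does (q ≟ p)) h ⟫ * (ι (suc n) - ι (suc s ℕ.+ k))
      ≡⟨ cong₂ (λ b t → ⟪ P , shiftIf b h ⟫ * (ι (suc n) - ι t)) (does-nextFree-≟ c j₀ free p) (sym (ℕₚ.+-suc s k)) ⟩
    ⟪ P , shiftIf (not (c p)) h ⟫ * r
      ≡⟨ cong (_* r) (shifted (c p)) ⟩
    (if c p then ⟪ P , h ⟫ else ⟪ P , h ∘ suc ⟫) * r ∎
    where q = nextFree c p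

-- The street as the circular street with its last spot left free

maybe-suc : ∀ (s : Maybe (Fin k)) → suc (maybe′ inject₁ (fromℕ k) s) ≡ maybe′ inject₁ (fromℕ (suc k)) (Maybe.map suc s)
maybe-suc nothing  = refl
maybe-suc (just _) = refl

-- `firstFree` recurses on the tail of the street, so the claim concerns any stretch of consecutive
-- spots followed by a free one, laid along the circle by `e`. Failing to park on the stretch means
-- reaching that free spot.
seek-firstFree : ∀ d (occ : Subset m) (c : Occupancy n) (e : Fin (suc m) → Fin (suc n)) →
  (∀ i → rotate (e (inject₁ i)) ≡ e (suc i)) → (∀ i → c (e (inject₁ i)) ≡ lookup occ i) →
  c (e (fromℕ m)) ≡ false → ∀ p → m ≤ toℕ p ℕ.+ d →
  seek d c (e (inject₁ p)) ≡ e (maybe′ inject₁ (fromℕ m) (firstFree occ p))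
seek-firstFree d (b ∷ occ) c e rot agree free (suc p) (s≤s m≤) = trans
  (seek-firstFree d occ c (e ∘ suc) (rot ∘ suc) (agree ∘ suc) free p m≤)
  (cong e (maybe-suc (firstFree occ p)))
seek-firstFree (suc d) (outside ∷ occ) c e rot agree free zero m≤ rewrite agree zero = refl
-- The stretch ends here, and the car rolls on to the free spot beyond it.
seek-firstFree (suc d) (inside ∷ []) c e rot agree free zero m≤
  rewrite agree zero | rot zero = seek-at-free d c (e (suc zero)) free
seek-firstFree (suc d) (inside ∷ b ∷ occ) c e rot agree free zero (s≤s m≤)
  rewrite agree zero | rot zero = trans
  (seek-firstFree d (b ∷ occ) c (e ∘ suc) (rot ∘ suc) (agree ∘ suc) free zero m≤)
  (cong e (maybe-suc (firstFree (b ∷ occ) zero)))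

count-tabulate : ∀ {P : B → Set} (P? : Decidable P) (g : A → B) (h : Fin k → A) →
  count P? (Vec.tabulate (g ∘ h)) ≡ count (P? ∘ g) (Vec.tabulate h)
count-tabulate {k = zero}  P? g h = refl
count-tabulate {k = suc k} P? g h with does (P? (g (h zero)))
... | true  = cong suc (count-tabulate P? g (h ∘ suc))
... | false = count-tabulate P? g (h ∘ suc)

allParked? : (spots : Vec (Maybe (Fin n)) k) → Dec (All Is-just spots)
allParked? = all? (anyᵐ? (λ _ → yes tt))

parkedAsPreferred? : (spots : Vec (Maybe (Fin n)) k) (as : Vec (Fin n) k) →
  Decidable (λ i → lookup spots i ≡ just (lookup as i))
parkedAsPreferred? spots as i = ≡-dec _≟_ (lookup spots i) (just (lookup as i))

luckyAmong : Vec (Maybe (Fin n)) k → Vec (Fin n) k → ℕ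
luckyAmong {k = k} spots as = count (parkedAsPreferred? spots as) (Vec.allFin k)

-- Phrased through `h`, so that a lucky first car appears as the same shift as in `circular`.
luckyAmong-∷ : ∀ q (a : Fin n) (spots : Vec (Maybe (Fin n)) k) as h →
  h (luckyAmong (just q ∷ spots) (a ∷ as)) ≡ shiftIf (does (q ≟ a)) h (luckyAmong spots as)
luckyAmong-∷ q a spots as h with does (q ≟ a)
... | true  = cong (h ∘ suc) (count-tabulate (parkedAsPreferred? (just q ∷ spots) (a ∷ as)) suc id)
... | false = cong h (count-tabulate (parkedAsPreferred? (just q ∷ spots) (a ∷ as)) suc id)

weight : Vec (Maybe (Fin n)) k → Vec (Fin n) k → (ℕ → ℚ) → ℚ
weight spots as h = if does (allParked? spots) then h (luckyAmong spots as) else 0ℚ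

weight-∷ : ∀ q (a : Fin n) (spots : Vec (Maybe (Fin n)) k) as h →
  weight (just q ∷ spots) (a ∷ as) h ≡ weight spots as (shiftIf (does (q ≟ a)) h)
weight-∷ q a spots as h =
  cong (λ x → if does (allParked? spots) then x else 0ℚ) (luckyAmong-∷ q a spots as h)

-- The counterpart of `circular` on the street; `weight` discards the sequences in which a car
-- fails.
linear : Subset n → ℕ → (ℕ → ℚ) → ℚ
linear {n} occ k h = total (sequences n k) (λ as → weight (park occ as) as h)

occupy-agrees : ∀ (occ : Subset n) (c : Occupancy n) → (∀ i → c (inject₁ i) ≡ lookup occ i) →
  ∀ q i → occupy c (inject₁ q) (inject₁ i) ≡ lookup (occ [ q ]≔ inside) i
occupy-agrees occ c agree q i with i ≟ q
... | yes refl = trans (cong (_∨ c (inject₁ q)) (dec-true (inject₁ q ≟ inject₁ q) refl)) (sym (lookup∘updateAt q occ))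
... | no i≢q   = trans (cong (_∨ c (inject₁ i)) (dec-false (inject₁ i ≟ inject₁ q) (i≢q ∘ inject₁-injective)))
  (trans (agree i) (sym (lookup∘updateAt′ i q i≢q occ)))

-- A car that fails on the street takes the extra spot of the circle, which then cannot stay free,
-- so both sides discard such sequences. Otherwise each car takes the same spot on both.
linear≡circular : ∀ k (occ : Subset n) (c : Occupancy n) h →
  (∀ i → c (inject₁ i) ≡ lookup occ i) → c (fromℕ n) ≡ false →
  linear occ k h ≡ circular c k (fromℕ n) h
linear≡circular zero occ c h agree free rewrite free = ℚₚ.+-identityʳ (h 0)
linear≡circular {n} (suc k) occ c h agree free = begin
  linear occ (suc k) h
    ≡⟨ total-cartesianProductWith {A = Fin n} {Vec (Fin n) k} _∷_ (tabulate id) (sequences n k) (λ as → weight (park occ as) as h) ⟩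
  total (tabulate id) (λ a → total (sequences n k) (λ as → weight (park occ (a ∷ as)) (a ∷ as) h))
    ≡⟨ total-tabulate {n} id (λ a → total (sequences n k) (λ as → weight (park occ (a ∷ as)) (a ∷ as) h)) ⟩
  sum (λ a → total (sequences n k) (λ as → weight (park occ (a ∷ as)) (a ∷ as) h))
    ≡⟨ sum-cong-≗ (λ a → trans (first-car a (firstFree occ a)) (cong (branch (inject₁ a)) (sym (nextFree-inject₁ a)))) ⟩
  sum (λ a → branch (inject₁ a) (nextFree c (inject₁ a)))
    -- The added 0 stands for a first car preferring the extra spot: it would take that spot.
    ≡⟨ ℚₚ.+-identityʳ _ ⟨
  sum (λ a → branch (inject₁ a) (nextFree c (inject₁ a))) + 0ℚ
    ≡⟨ cong (sum (λ a → branch (inject₁ a) (nextFree c (inject₁ a))) +_) (trans (cong (branch (fromℕ n)) (seek-at-free n c (fromℕ n) free)) (branch-last (fromℕ n))) ⟨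
  sum (λ a → branch (inject₁ a) (nextFree c (inject₁ a))) + branch (fromℕ n) (nextFree c (fromℕ n))
    ≡⟨ sum-init-last (λ p → branch p (nextFree c p)) ⟨
  circular c (suc k) (fromℕ n) h ∎
  where
  open ≡-Reasoning

  branch : Fin (suc n) → Fin (suc n) → ℚ
  branch p q = circular (occupy c q) k (fromℕ n) (shiftIf (does (q ≟ p)) h)

  branch-last : ∀ p → branch p (fromℕ n) ≡ 0ℚ
  branch-last p = circular-occupied (occupy c (fromℕ n)) k (fromℕ n) _
    (cong (_∨ c (fromℕ n)) (dec-true (fromℕ n ≟ fromℕ n) refl))

  nextFree-inject₁ : ∀ a → nextFree c (inject₁ a) ≡ maybe′ inject₁ (fromℕ n) (firstFree occ a)
  nextFree-inject₁ a = seek-firstFree n occ c id rotate-inject₁ agree free a (ℕₚ.m≤n+m n (toℕ a))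

  first-car : ∀ a s →
    total (sequences n k) (λ as → weight (s ∷ park (maybe (λ q → occ [ q ]≔ inside) occ s) as) (a ∷ as) h)
      ≡ branch (inject₁ a) (maybe′ inject₁ (fromℕ n) s)
  -- The left side is 0 because a car has failed, the right side because the extra spot is taken.
  first-car a nothing  = trans (total-zero (sequences n k)) (sym (branch-last (inject₁ a)))
  first-car a (just q) = begin
    total (sequences n k) (λ as → weight (just q ∷ park (occ [ q ]≔ inside) as) (a ∷ as) h)
      ≡⟨ total-cong (sequences n k) (λ as → weight-∷ q a (park (occ [ q ]≔ inside) as) as h) ⟩
    linear (occ [ q ]≔ inside) k (shiftIf (does (q ≟ a)) h)
      ≡⟨ linear≡circular k (occ [ q ]≔ inside) (occupy c (inject₁ q)) _ (occupy-agrees occ c agree q)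
           (trans (cong (_∨ c (fromℕ n)) (dec-false (fromℕ n ≟ inject₁ q) fromℕ≢inject₁)) free) ⟩
    circular (occupy c (inject₁ q)) k (fromℕ n) (shiftIf (does (q ≟ a)) h)
      ≡⟨ cong (λ b → circular (occupy c (inject₁ q)) k (fromℕ n) (shiftIf b h))
           (does-≟-injective inject₁ inject₁-injective q a) ⟨
    branch (inject₁ a) (inject₁ q) ∎

-- Parking functions and factorial moments

-- Parking functions correspond to leaving the extra spot free; by symmetry, n + 1 times their sum
-- is the sum over all spots left free.
total-parkingFunctions : ∀ n h →
  ι (suc n) * total (parkingFunctions n) (h ∘ luckyCars) ≡ ⟪ factors n 0 n , h ⟫
total-parkingFunctions n h = begin
  ι (suc n) * total (parkingFunctions n) (h ∘ luckyCars)
    ≡⟨ cong (ι (suc n) *_) (total-filter isParkingFunction? (sequences n n) (h ∘ luckyCars)) ⟩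
  ι (suc n) * linear ⊥ n h
    ≡⟨ cong (ι (suc n) *_) (linear≡circular n ⊥ (λ _ → false) h (λ i → sym (lookup-replicate i outside)) refl) ⟩
  ι (suc n) * circular (λ _ → false) n (fromℕ n) h
    ≡⟨ sum-const (suc n) _ ⟨
  sum {suc n} (λ _ → circular (λ _ → false) n (fromℕ n) h)
    ≡⟨ sum-cong-≗ (circular-const n h) ⟨
  sum (λ j → circular (λ _ → false) n j h)
    ≡⟨ sum-circular (λ _ → false) 0 n h (occupied-empty (suc n)) ℕₚ.≤-refl ⟩
  ⟪ factors n 0 n , h ⟫ * (ι (suc n) - ι n)
    -- After n cars exactly one of the n + 1 spots is free, so the last factor is 1.
    ≡⟨ cong (λ x → ⟪ factors n 0 n , h ⟫ * (x - ι n)) (ι-suc n) ⟩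
  ⟪ factors n 0 n , h ⟫ * (1ℚ + ι n - ι n)
    ≡⟨ solve 2 (λ x n → x :* (con 1ℚ :+ n :- n) := x) refl ⟪ factors n 0 n , h ⟫ (ι n) ⟩
  ⟪ factors n 0 n , h ⟫ ∎
  where open ≡-Reasoning

-- The constant 1/(n + 1) in `f` cancels the n + 1 coming from the rotations.
⟪f,⟫ : ∀ n h → ⟪ f n , h ⟫ ≡ total (parkingFunctions n) (h ∘ luckyCars)
⟪f,⟫ n h = begin
  ⟪ f n , h ⟫                     ≡⟨ ⟪·,⟫ r (foldr _⊗_ (1ℚ ∷ []) (map (linearFactor n) (applyUpTo suc n))) h ⟩
  r * ⟪ foldr _⊗_ (1ℚ ∷ []) (map (linearFactor n) (applyUpTo suc n)) , h ⟫
    ≡⟨ cong (λ p → r * ⟪ p , h ⟫) (foldr-factors n 0 n suc (λ _ → refl)) ⟩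
  r * ⟪ factors n 0 n , h ⟫       ≡⟨ cong (r *_) (total-parkingFunctions n h) ⟨
  r * (ι (suc n) * S)             ≡⟨ ℚₚ.*-assoc r (ι (suc n)) S ⟨
  r * ι (suc n) * S               ≡⟨ cong (_* S) (ι-inverse (suc n)) ⟩
  1ℚ * S                          ≡⟨ ℚₚ.*-identityˡ S ⟩
  S                               ∎
  where
  open ≡-Reasoning
  r = pos 1 / suc n
  S = total (parkingFunctions n) (h ∘ luckyCars)

-- Taking `h` constantly 1 counts: n + 2 times the number of parking functions is (n + 2)^(n + 1).
length-parkingFunctions : ∀ n → length (parkingFunctions (suc n)) ≡ suc (suc n) ℕ.^ n
length-parkingFunctions n = ℕₚ.*-cancelˡ-≡ _ _ (suc (suc n)) (ι-injective (begin
  ι (suc (suc n) ℕ.* length xs)        ≡⟨ ι-* (suc (suc n)) (length xs) ⟩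
  ι (suc (suc n)) * ι (length xs)      ≡⟨ cong (ι (suc (suc n)) *_) (total-one xs) ⟨
  ι (suc (suc n)) * total xs (λ _ → 1ℚ) ≡⟨ total-parkingFunctions (suc n) (λ _ → 1ℚ) ⟩
  ⟪ factors (suc n) 0 (suc n) , (λ _ → 1ℚ) ⟫ ≡⟨ factors-one (suc n) 0 (suc n) ⟩
  ι (suc (suc n) ℕ.^ suc n)            ∎))
  where
  open ≡-Reasoning
  xs = parkingFunctions (suc n)

proposition2p1 : (n : ℕ) → 1 ≤ n → (ℓ : ℕ) → 1 ≤ ℓ →
    𝔼 (parkingFunctions n) (λ a → fallingFactorial (ι (luckyCars a)) ℓ)
    ≡ 1/[1+n]^ n (n ∸ 1) * eval (iteratedDerivative ℓ (f n)) 1ℚ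
proposition2p1 (suc n) _ ℓ _ = begin
  𝔼 (parkingFunctions (suc n)) (h ∘ luckyCars)
    ≡⟨ 𝔼-total (parkingFunctions (suc n)) (h ∘ luckyCars) (suc (suc n) ℕ.^ n) {{ℕₚ.m^n≢0 (suc (suc n)) n}} (length-parkingFunctions n) ⟩
  1/[1+n]^ (suc n) n * total (parkingFunctions (suc n)) (h ∘ luckyCars)
    ≡⟨ cong (1/[1+n]^ (suc n) n *_) (⟪f,⟫ (suc n) h) ⟨
  1/[1+n]^ (suc n) n * ⟪ f (suc n) , h ⟫
    -- On falling factorials the functional of `f` is its ℓ-th derivative at 1.
    ≡⟨ cong (1/[1+n]^ (suc n) n *_) (eval-iteratedDerivative ℓ (f (suc n))) ⟨
  1/[1+n]^ (suc n) n * eval (iteratedDerivative ℓ (f (suc n))) 1ℚ ∎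
  where
  open ≡-Reasoning
  h : ℕ → ℚ
  h k = fallingFactorial (ι k) ℓ
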